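{- Let $G$ be a graph with maximum degree $\Delta \geq 4$. If $\mathrm{mad}(G) < \frac{14}{5}$, then $\chi_i(G) \leq \Delta + 2$.
   Context: All graphs are finite and simple. For a graph $G$, $\mathrm{mad}(G)$ denotes the maximum average degree of $G$, i.e. the maximum of $2|E(H)|/|V(H)|$ over all nonempty subgraphs $H$ of $G$. An injective coloring of $G$ is an assignment of colors to the vertices of $G$ such that any two vertices having a common neighbor receive distinct colors (adjacent vertices need not receive distinct colors unless they have a common neighbor). The injective chromatic number $\chi_i(G)$ is the minimum number of colors in an injective coloring of $G$. $\Delta$ denotes the maximum degree of $G$. -}

module Defs where

open import Data.Nat using (ℕ; zero; suc; _+_; _*_; _⊔_; _<_)
open import Data.Bool using (Bool; true; false; T; if_then_else_; _∧_)
open import Data.Fin using (Fin)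
open import Data.List using (List; map; foldr; allFin)
open import Data.Nat.ListAction using (sum)
open import Data.Product using (Σ; _×_; ∃)
open import Relation.Binary.PropositionalEquality using (_≡_; _≢_)

record Graph : Set where
  field
    n     : ℕ
    adj   : Fin n → Fin n → Bool
    sym   : ∀ u v → adj u v ≡ adj v u
    irrefl : ∀ v → adj v v ≡ false
open Graph public

count : (m : ℕ) → (Fin m → Bool) → ℕ
count m p = sum (map (λ i → if p i then 1 else 0) (allFin m))

degree : (G : Graph) → Fin (n G) → ℕ
degree G v = count (n G) (adj G v)

maxDegree : Graph → ℕ
maxDegree G = foldr _⊔_ 0 (map (degree G) (allFin (n G)))

record Subgraph (G : Graph) : Set where
  field
    S    : Fin (n G) → Bool
    F    : Fin (n G) → Fin (n G) → Bool
    Fsym : ∀ u v → F u v ≡ F v u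
    Fsub : ∀ u v → T (F u v) → T (adj G u v ∧ (S u ∧ S v))
open Subgraph public

vcount : (G : Graph) → Subgraph G → ℕ
vcount G H = count (n G) (S H)

-- 2|E(H)| = number of ordered pairs (u,v) with uv ∈ E(H)
twiceEcount : (G : Graph) → Subgraph G → ℕ
twiceEcount G H = sum (map (λ u → count (n G) (F H u)) (allFin (n G)))

-- mad(G) < 14/5 : every nonempty subgraph H has 2|E(H)|/|V(H)| < 14/5,
-- i.e. 5·(2|E(H)|) < 14·|V(H)|.
madLt14/5 : Graph → Set
madLt14/5 G = ∀ (H : Subgraph G) → 0 < vcount G H →
  5 * twiceEcount G H < 14 * vcount G H

IsInjectiveColoring : (G : Graph) (k : ℕ) → (Fin (n G) → Fin k) → Set
IsInjectiveColoring G k c = ∀ u v w → u ≢ v → T (adj G u w) → T (adj G v w) → c u ≢ c v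

χi≤ : Graph → ℕ → Set
χi≤ G k = Σ (Fin (n G) → Fin k) (IsInjectiveColoring G k)

{-# OPTIONS --safe #-}
module Submission where

-- In a minimal counterexample, deleting an edge vu whose end v sees at most D + 1 vertices leaves a
-- colouring with conflicts only at v and at a hole u. If the vertex at the hole sees at most D + 1
-- others the colouring can be completed; if it sees D + 2 they carry all colours once each, and the
-- hole can be exchanged with any of them. View the 2-vertices with a neighbour of degree 4 as edges
-- ("links") between their neighbours. Sliding the hole along them shows that the component of a
-- 4-vertex with too many 2-neighbours is a tree: on a cycle, two routes of the hole would
-- leave different colours around the same vertex. A tree has fewer links than nodes, so every 2-vertex
-- can be supplied by discharging, and the average degree over the non-isolated vertices is at least 14/5.

open import Defs
import Algebra.Properties.CommutativeSemigroup as CommutativeSemigroupProperties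
open import Data.Bool using (Bool; true; false; T; if_then_else_; _∧_; _∨_; not)
open import Data.Bool.Properties using (T?; T-∧; ∧-comm; ∨-comm)
open import Data.Empty using (⊥-elim)
open import Data.Fin using (Fin; toℕ; fromℕ<; finToFun; funToFin) renaming (zero to fzero; suc to fsuc)
open import Data.Fin.Properties using (_≟_; all?; any?; ¬∀⟶∃¬; injective⇒≤; finToFun-funToFin; toℕ-injective)
open import Data.List using (List; []; _∷_; _++_; map; filter; length; concatMap; allFin; lookup; foldr)
open import Data.List.Membership.Propositional using (_∈_; find; lose)
open import Data.List.Membership.Propositional.Properties using (∈-filter⁺; ∈-filter⁻; ∈-allFin; ∈-∃++; ∈-++⁺ˡ; ∈-++⁺ʳ; ∈-++⁻; ∈-concatMap⁺; ∈-concatMap⁻)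
open import Data.List.Properties using (length-++; length-++-sucʳ; ++-assoc; filter-notAll)
open import Data.List.Relation.Unary.All as All using (All; []; _∷_)
open import Data.List.Relation.Unary.Any as Any using (Any; here; there)
open import Data.List.Relation.Unary.Any.Properties using (lookup-index)
open import Data.List.Relation.Unary.AllPairs using ([]; _∷_)
open import Data.List.Relation.Unary.Unique.Propositional using (Unique)
open import Data.List.Relation.Unary.Unique.Propositional.Properties as Unique using ()
open import Data.Nat using (ℕ; zero; suc; _+_; _*_; _∸_; _⊔_; _≤_; _<_; _≤ᵇ_; _<ᵇ_; z≤n; s≤s)
open import Data.Nat.Induction using (<-wellFounded)
open import Data.Nat.ListAction using (sum)
open import Data.Nat.Properties hiding (_≟_)
open import Data.Product using (∃; ∃-syntax; _×_; _,_; proj₁; proj₂)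
open import Data.Sum using (_⊎_; inj₁; inj₂; [_,_]′; swap) renaming (map to mapSum)
open import Data.Unit using (⊤; tt)
open import Data.Vec.Functional using (updateAt)
open import Data.Vec.Functional.Properties using (updateAt-updates; updateAt-minimal)
open import Function using (_∘_; id; const)
open import Function.Bundles using (Equivalence)
open import Induction.WellFounded using (Acc; acc)
open import Relation.Binary.PropositionalEquality using (_≡_; _≢_; refl; trans; cong; cong₂; subst; subst₂; ≢-sym) renaming (sym to ≡-sym)
open import Relation.Nullary using (¬_; Dec; yes; no; does)
open import Relation.Nullary.Decidable using (¬?; _×-dec_; _→-dec_; map′; ¬¬-excluded-middle; decidable-stable)

open CommutativeSemigroupProperties +-commutativeSemigroup using (interchange)

-- Sums and finite lists

module _ {A : Set} where

  sum-mono-≤ : {f g : A → ℕ} (l : List A) → (∀ {a} → a ∈ l → f a ≤ g a) →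
    sum (map f l) ≤ sum (map g l)
  sum-mono-≤ []      f≤g = z≤n
  sum-mono-≤ (a ∷ l) f≤g = +-mono-≤ (f≤g (here refl)) (sum-mono-≤ l (f≤g ∘ there))

  sum-mono-< : {f g : A → ℕ} {a : A} {l : List A} → (∀ b → f b ≤ g b) → a ∈ l → f a < g a →
    sum (map f l) < sum (map g l)
  sum-mono-< {l = _ ∷ l} f≤g (here refl) f<g = +-mono-<-≤ f<g (sum-mono-≤ l λ _ → f≤g _)
  sum-mono-< {l = b ∷ l} f≤g (there a∈) f<g = +-mono-≤-< (f≤g b) (sum-mono-< f≤g a∈ f<g)

  sum-cong : {f g : A → ℕ} (l : List A) → (∀ a → f a ≡ g a) → sum (map f l) ≡ sum (map g l)
  sum-cong []      f≡g = refl
  sum-cong (a ∷ l) f≡g = cong₂ _+_ (f≡g a) (sum-cong l f≡g)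

  sum-0 : (l : List A) → sum (map (const 0) l) ≡ 0
  sum-0 []      = refl
  sum-0 (a ∷ l) = sum-0 l

  sum-+ : (f g : A → ℕ) (l : List A) →
    sum (map (λ a → f a + g a) l) ≡ sum (map f l) + sum (map g l)
  sum-+ f g []      = refl
  sum-+ f g (a ∷ l) = trans (cong (f a + g a +_) (sum-+ f g l)) (interchange (f a) (g a) _ _)

  sum-* : (k : ℕ) (f : A → ℕ) (l : List A) → sum (map (λ a → k * f a) l) ≡ k * sum (map f l)
  sum-* k f []      = ≡-sym (*-zeroʳ k)
  sum-* k f (a ∷ l) = trans (cong (k * f a +_) (sum-* k f l)) (≡-sym (*-distribˡ-+ k (f a) _))

  sum-filter : (p : A → Bool) (f : A → ℕ) (l : List A) →
    sum (map f (filter (λ a → T? (p a)) l)) ≡ sum (map (λ a → if p a then f a else 0) l)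
  sum-filter p f []      = refl
  sum-filter p f (a ∷ l) with p a
  ... | true  = cong (f a +_) (sum-filter p f l)
  ... | false = sum-filter p f l

  length-filter-T : (p : A → Bool) (l : List A) →
    length (filter (λ a → T? (p a)) l) ≡ sum (map (λ a → if p a then 1 else 0) l)
  length-filter-T p []      = refl
  length-filter-T p (a ∷ l) with p a
  ... | true  = cong suc (length-filter-T p l)
  ... | false = length-filter-T p l

  -- Used to bound what a vertex pays: every neighbour costs at most `b`, except that the single
  -- upward link may cost `e` more. Once the exception is met, uniqueness puts the whole tail under
  -- the bound `b`.
  sum-one-exception : (P : A → Set) → (∀ a → Dec (P a)) → (f : A → ℕ) (b e : ℕ) {l : List A} →
    Unique l → (∀ {x y} → x ∈ l → y ∈ l → P x → P y → x ≡ y) →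
    (∀ {x} → x ∈ l → ¬ P x → f x ≤ b) → (∀ {x} → x ∈ l → f x ≤ b + e) →
    sum (map f l) ≤ length l * b + e
  sum-one-exception P P? f b e {[]} _ _ _ _ = z≤n
  sum-one-exception P P? f b e {a ∷ l} (a∉ ∷ l!) P! f≤b f≤b+e with P? a
  ... | no ¬Pa = ≤-trans
    (+-mono-≤ (f≤b (here refl) ¬Pa)
      (sum-one-exception P P? f b e l! (λ x∈ y∈ → P! (there x∈) (there y∈)) (f≤b ∘ there) (f≤b+e ∘ there)))
    (≤-reflexive (≡-sym (+-assoc b (length l * b) e)))
  ... | yes Pa = ≤-trans (+-mono-≤ (f≤b+e (here refl)) (rest l λ x∈ →
      f≤b (there x∈) λ Px → All.lookup a∉ x∈ (P! (here refl) (there x∈) Pa Px)))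
    (≤-reflexive (trans (+-assoc b e _) (trans (cong (b +_) (+-comm e _)) (≡-sym (+-assoc b _ e)))))
    where
    rest : (m : List A) → (∀ {x} → x ∈ m → f x ≤ b) → sum (map f m) ≤ length m * b
    rest []      _   = z≤n
    rest (x ∷ m) f≤b = +-mono-≤ (f≤b (here refl)) (rest m (f≤b ∘ there))

sum-swap : {A B : Set} (f : A → B → ℕ) (l : List A) (m : List B) →
  sum (map (λ a → sum (map (f a) m)) l) ≡ sum (map (λ b → sum (map (λ a → f a b) l)) m)
sum-swap f []      m = ≡-sym (sum-0 m)
sum-swap f (a ∷ l) m = trans (cong (sum (map (f a) m) +_) (sum-swap f l m)) (≡-sym (sum-+ (f a) _ m))

module _ {A : Set} where

  ∈-drop-middle : ∀ (l₁ : List A) {l₂ s t} → t ∈ l₁ ++ s ∷ l₂ → t ≢ s → t ∈ l₁ ++ l₂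
  ∈-drop-middle l₁ t∈ t≢s with ∈-++⁻ l₁ t∈
  ... | inj₁ t∈l₁         = ∈-++⁺ˡ t∈l₁
  ... | inj₂ (here t≡s)   = ⊥-elim (t≢s t≡s)
  ... | inj₂ (there t∈l₂) = ∈-++⁺ʳ l₁ t∈l₂

  two-elements : {l : List A} → length l ≡ 2 → ∃[ a ] ∃[ b ] l ≡ a ∷ b ∷ []
  two-elements {a ∷ b ∷ []} refl = a , b , refl

  three-elements : {l : List A} → length l ≡ 3 → ∃[ a ] ∃[ b ] ∃[ c ] l ≡ a ∷ b ∷ c ∷ []
  three-elements {a ∷ b ∷ c ∷ []} refl = a , b , c , refl

  four-elements : {l : List A} → length l ≡ 4 → ∃[ a ] ∃[ b ] ∃[ c ] ∃[ d ] l ≡ a ∷ b ∷ c ∷ d ∷ []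
  four-elements {a ∷ b ∷ c ∷ d ∷ []} refl = a , b , c , d , refl

  -- Covering all k colours needs k vertices; with at most k of them, none is superfluous.
  covers⇒≤ : ∀ {k} (l : List A) (c : A → Fin k) → (∀ i → ∃[ s ] s ∈ l × c s ≡ i) → k ≤ length l
  covers⇒≤ l c cover = injective⇒≤ {f = λ i → Any.index (proj₁ (proj₂ (cover i)))} λ {i} {j} eq →
    let (s , s∈ , cs≡i) = cover i ; (t , t∈ , ct≡j) = cover j in
    trans (≡-sym cs≡i) (trans (cong c (trans (lookup-index s∈)
      (trans (cong (lookup l) eq) (≡-sym (lookup-index t∈))))) ct≡j)

  module _ {k} {l : List A} (c : A → Fin k) (l≤k : length l ≤ k) where

    covers⇒critical : ∀ l₁ {s l₂} → l ≡ l₁ ++ s ∷ l₂ → ¬ (∀ i → ∃[ t ] t ∈ l₁ ++ l₂ × c t ≡ i)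
    covers⇒critical l₁ {s} {l₂} refl cover = <-irrefl refl (begin-strict
      k                      ≤⟨ covers⇒≤ (l₁ ++ l₂) c cover ⟩
      length (l₁ ++ l₂)      <⟨ n<1+n _ ⟩
      suc (length (l₁ ++ l₂)) ≡⟨ length-++-sucʳ l₁ s l₂ ⟨
      length (l₁ ++ s ∷ l₂)  ≤⟨ l≤k ⟩
      k                      ∎)
      where open ≤-Reasoning

    module _ (cover : ∀ i → ∃[ s ] s ∈ l × c s ≡ i) (_≟_ : (s t : A) → Dec (s ≡ t)) where

      -- If the colour of `s` occurred elsewhere, `s` could be dropped without losing a colour.
      -- Positions rather than values are compared, so with `t` equal to `s` this also excludes
      -- repeated entries.
      covers⇒rainbow : ∀ l₁ {s l₂} → l ≡ l₁ ++ s ∷ l₂ → ∀ {t} → t ∈ l₁ ++ l₂ → c t ≢ c s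
      covers⇒rainbow l₁ {s} refl {t} t∈ ct≡cs = covers⇒critical l₁ refl λ i →
        let (u , u∈ , cu≡i) = cover i in replace i u u∈ cu≡i
        where
        replace : ∀ i u → u ∈ l → c u ≡ i → ∃[ t ] t ∈ l₁ ++ _ × c t ≡ i
        replace i u u∈ cu≡i with u ≟ s
        ... | yes refl = t , t∈ , trans ct≡cs cu≡i
        ... | no u≢s   = u , ∈-drop-middle l₁ u∈ u≢s , cu≡i

      covers⇒injective : ∀ {s t} → s ∈ l → t ∈ l → c s ≡ c t → s ≡ t
      covers⇒injective {s} {t} s∈ t∈ cs≡ct with s ≟ t | ∈-∃++ t∈
      ... | yes s≡t | _ = s≡t
      ... | no s≢t  | (l₁ , _ , refl) = ⊥-elim (covers⇒rainbow l₁ refl (∈-drop-middle l₁ s∈ s≢t) cs≡ct)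

-- Decisions over finite types

-- Connection by walks is never decided here, but the final goal is a contradiction, and there
-- finitely many instances of excluded middle may be assumed.
¬¬-decide : ∀ {n} (P : Fin n → Set) → ¬ ¬ (∀ i → Dec (P i))
¬¬-decide {zero}  P ¬dec = ¬dec λ ()
¬¬-decide {suc n} P ¬dec = ¬¬-excluded-middle λ P0? → ¬¬-decide (P ∘ fsuc) λ P? →
  ¬dec λ { fzero → P0? ; (fsuc i) → P? i }

¬¬-decide₂ : ∀ {m n} (P : Fin m → Fin n → Set) → ¬ ¬ (∀ i j → Dec (P i j))
¬¬-decide₂ {zero}  P ¬dec = ¬dec λ ()
¬¬-decide₂ {suc m} P ¬dec = ¬¬-decide (P fzero) λ P0? → ¬¬-decide₂ (P ∘ fsuc) λ P? →
  ¬dec λ { fzero → P0? ; (fsuc i) → P? i }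

-- Functions are enumerated through their codes in a finite type; `resp` replaces function
-- extensionality, as decoding recovers a function only pointwise.
any-function? : ∀ {m k} {P : (Fin m → Fin k) → Set} → (∀ f → Dec (P f)) →
  (∀ {f g} → (∀ i → f i ≡ g i) → P f → P g) → Dec (∃ P)
any-function? {m} {k} {P} P? resp =
  map′ (λ (i , p) → finToFun i , p)
       (λ (f , p) → funToFin f , resp (λ i → ≡-sym (finToFun-funToFin f i)) p)
       (any? λ i → P? (finToFun {k} {m} i))

χi≤? : (G : Graph) (k : ℕ) → Dec (χi≤ G k)
χi≤? G k = any-function?
  (λ c → all? λ u → all? λ v → all? λ w →
    ¬? (u ≟ v) →-dec T? (adj G u w) →-dec T? (adj G v w) →-dec ¬? (c u ≟ c v))
  (λ f≗g P u v w u≢v uw vw gu≡gv → P u v w u≢v uw vw (trans (f≗g u) (trans gu≡gv (≡-sym (f≗g v)))))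

-- Edge deletion

module _ (G : Graph) where

  isEdge : (u v a b : Fin (n G)) → Bool
  isEdge u v a b = (does (a ≟ u) ∧ does (b ≟ v)) ∨ (does (a ≟ v) ∧ does (b ≟ u))

  deleteEdge : (u v : Fin (n G)) → Graph
  deleteEdge u v = record
    { n      = n G
    ; adj    = λ a b → adj G a b ∧ not (isEdge u v a b)
    ; sym    = λ a b → cong₂ _∧_ (sym G a b) (cong not (isEdge-sym a b))
    ; irrefl = λ a → cong (_∧ not (isEdge u v a a)) (irrefl G a)
    }
    where
    isEdge-sym : ∀ a b → isEdge u v a b ≡ isEdge u v b a
    isEdge-sym a b = trans (∨-comm (does (a ≟ u) ∧ does (b ≟ v)) _)
      (cong₂ _∨_ (∧-comm (does (a ≟ v)) _) (∧-comm (does (a ≟ u)) _))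

  module _ {u v : Fin (n G)} where

    deleteEdge⁺ : ∀ {a b} → T (adj G a b) → ¬ (a ≡ u × b ≡ v) → ¬ (a ≡ v × b ≡ u) →
      T (adj (deleteEdge u v) a b)
    deleteEdge⁺ {a} {b} ab ≢uv ≢vu with a ≟ u | b ≟ v | a ≟ v | b ≟ u
    ... | yes p | yes q | _     | _     = ⊥-elim (≢uv (p , q))
    ... | no _  | _     | yes p | yes q = ⊥-elim (≢vu (p , q))
    ... | yes _ | no _  | yes p | yes q = ⊥-elim (≢vu (p , q))
    ... | no _  | _     | no _  | _     = Equivalence.from T-∧ (ab , tt)
    ... | no _  | _     | yes _ | no _  = Equivalence.from T-∧ (ab , tt)
    ... | yes _ | no _  | no _  | _     = Equivalence.from T-∧ (ab , tt)
    ... | yes _ | no _  | yes _ | no _  = Equivalence.from T-∧ (ab , tt)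

    indicator-mono : ∀ x y → (if x ∧ y then 1 else 0) ≤ (if x then 1 else 0)
    indicator-mono false y     = z≤n
    indicator-mono true  false = z≤n
    indicator-mono true  true  = s≤s z≤n

    degree-deleteEdge : ∀ a → degree (deleteEdge u v) a ≤ degree G a
    degree-deleteEdge a = sum-mono-≤ (allFin (n G)) λ {b} _ → indicator-mono (adj G a b) _

    size-deleteEdge : T (adj G u v) →
      sum (map (degree (deleteEdge u v)) (allFin (n G))) < sum (map (degree G) (allFin (n G)))
    size-deleteEdge uv = sum-mono-< degree-deleteEdge (∈-allFin u)
      (sum-mono-< (λ b → indicator-mono (adj G u b) _) (∈-allFin v) (lost uv))
      where
      lost : T (adj G u v) →
        (if adj G u v ∧ not (isEdge u v u v) then 1 else 0) < (if adj G u v then 1 else 0)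
      lost uv with adj G u v | uv | u ≟ u | v ≟ v
      ... | true | _ | yes _ | yes _ = s≤s z≤n
      ... | true | _ | no u≢u | _    = ⊥-elim (u≢u refl)
      ... | true | _ | yes _ | no v≢v = ⊥-elim (v≢v refl)

    -- Every subgraph left after the deletion is already a subgraph of `G`, with the same counts.
    mad-deleteEdge : madLt14/5 G → madLt14/5 (deleteEdge u v)
    mad-deleteEdge mad H = mad record
      { S = S H ; F = F H ; Fsym = Fsym H
      ; Fsub = λ a b ab → drop (adj G a b) _ (Fsub H a b ab) }
      where
      drop : ∀ x y {z} → T ((x ∧ y) ∧ z) → T (x ∧ z)
      drop true true xyz = xyz

-- The ordinary payment of a vertex of degree at least 4 to a neighbour of the given degree, outside
-- the core trees.
weight : ℕ → ℕ
weight 2 = 2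
weight 3 = 1
weight _ = 0

weight≤2 : ∀ d → weight d ≤ 2
weight≤2 0 = z≤n
weight≤2 1 = z≤n
weight≤2 2 = ≤-refl
weight≤2 3 = n≤1+n 1
weight≤2 (suc (suc (suc (suc _)))) = z≤n

-- From here on G is a minimal counterexample.
module Critical (G : Graph) (D : ℕ) (4≤D : 4 ≤ D) (degree≤D : ∀ v → degree G v ≤ D)
  (¬colourable : ¬ χi≤ G (D + 2))
  (deleted : ∀ {u v} → T (adj G u v) → χi≤ (deleteEdge G u v) (D + 2)) where

  -- Neighbourhoods and conflict lists

  V : Set
  V = Fin (n G)

  infix 4 _~_
  _~_ : V → V → Set
  u ~ v = T (adj G u v)

  ~-sym : ∀ {u v} → u ~ v → v ~ u
  ~-sym {u} {v} = subst T (sym G u v)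

  N : V → List V
  N v = filter (λ u → T? (adj G v u)) (allFin (n G))

  ∈N⁺ : ∀ {u v} → v ~ u → u ∈ N v
  ∈N⁺ {u} = ∈-filter⁺ (λ u → T? _) (∈-allFin u)

  ∈N⁻ : ∀ {u v} → u ∈ N v → v ~ u
  ∈N⁻ {u} {v} u∈ = proj₂ (∈-filter⁻ (λ u → T? (adj G v u)) {xs = allFin (n G)} u∈)

  N! : ∀ v → Unique (N v)
  N! v = Unique.filter⁺ (λ u → T? (adj G v u)) (Unique.allFin⁺ (n G))

  deg : V → ℕ
  deg v = length (N v)

  deg≡degree : ∀ v → deg v ≡ degree G v
  deg≡degree v = length-filter-T (adj G v) (allFin (n G))

  deg≤D : ∀ v → deg v ≤ D
  deg≤D v = subst (_≤ D) (≡-sym (deg≡degree v)) (degree≤D v)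

  -- conf v lists the vertices in conflict with v once for each common neighbour.
  others : V → V → List V
  others v w = filter (λ s → ¬? (s ≟ v)) (N w)

  conf : V → List V
  conf v = concatMap (others v) (N v)

  ∈others⁺ : ∀ {v w s} → s ≢ v → w ~ s → s ∈ others v w
  ∈others⁺ {v} s≢v ws = ∈-filter⁺ (λ s → ¬? (s ≟ v)) (∈N⁺ ws) s≢v

  ∈conf⁺ : ∀ {v s} w → v ~ w → s ~ w → s ≢ v → s ∈ conf v
  ∈conf⁺ {v} {s} w vw sw s≢v = ∈-concatMap⁺ (others v) (Any.map on (∈N⁺ vw))
    where
    on : ∀ {x} → w ≡ x → s ∈ others v x
    on refl = ∈others⁺ s≢v (~-sym sw)

  ∈conf⁻ : ∀ {v s} → s ∈ conf v → s ≢ v × ∃[ w ] v ~ w × s ~ w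
  ∈conf⁻ {v} {s} s∈ = go (∈N⁻ {v = v}) (∈-concatMap⁻ (others v) {xs = N v} s∈)
    where
    go : ∀ {l} → (∀ {w} → w ∈ l → v ~ w) → Any (λ w → s ∈ others v w) l →
      s ≢ v × ∃[ w ] v ~ w × s ~ w
    go l~ (here {w} s∈w) with ∈-filter⁻ (λ s → ¬? (s ≟ v)) {xs = N w} s∈w
    ... | s∈N , s≢v = s≢v , w , l~ (here refl) , ~-sym (∈N⁻ s∈N)
    go l~ (there p) = go (l~ ∘ there) p

  -- Each neighbour `w` has `v` itself in `N w`, and `others` drops it; hence the `∸ 1`.
  length-conf : ∀ v → length (conf v) ≤ sum (map (λ w → deg w ∸ 1) (N v))
  length-conf v = go (N v) (λ w∈ → ~-sym (∈N⁻ w∈))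
    where
    go : ∀ l → (∀ {w} → w ∈ l → w ~ v) →
      length (concatMap (others v) l) ≤ sum (map (λ w → deg w ∸ 1) l)
    go []      _  = z≤n
    go (w ∷ l) l~ = subst (_≤ _) (≡-sym (length-++ (others v w)))
      (+-mono-≤ (<⇒≤pred (filter-notAll (λ s → ¬? (s ≟ v)) (N w)
        (Any.map (λ { refl v≢v → v≢v refl }) (∈N⁺ (l~ (here refl))))))
        (go l (l~ ∘ there)))

  -- Colourings with a hole

  Colouring : Set
  Colouring = V → Fin (D + 2)

  -- The vertices `p` and `q` count as uncoloured, whatever `c` assigns to them. `Good c p p`
  -- describes a single hole.
  Good : Colouring → V → V → Set
  Good c p q = ∀ {a b} w → a ≢ b → a ~ w → b ~ w →
    a ≢ p → a ≢ q → b ≢ p → b ≢ q → c a ≢ c b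

  -- With `D + 2` colours such a vertex has a free colour when it is coloured last.
  Easy : V → Set
  Easy v = length (conf v) ≤ D + 1

  infixl 5 _[_↦_]
  _[_↦_] : Colouring → V → Fin (D + 2) → Colouring
  c [ v ↦ k ] = updateAt c v (const k)

  updated : ∀ (c : Colouring) v {k} → (c [ v ↦ k ]) v ≡ k
  updated c v = updateAt-updates v c

  kept : ∀ (c : Colouring) v {k a} → a ≢ v → (c [ v ↦ k ]) a ≡ c a
  kept c v {a = a} = updateAt-minimal a v c

  fill : ∀ {c p q k} → Good c p q → (∀ {s} → s ∈ conf q → s ≢ p → c s ≢ k) → Good (c [ q ↦ k ]) p p
  fill {c} {p} {q} {k} good free {a} {b} w a≢b aw bw a≢p _ b≢p _ with a ≟ q | b ≟ q
  ... | yes refl | yes refl = ⊥-elim (a≢b refl)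
  ... | yes refl | no b≢q   = λ eq → free (∈conf⁺ w aw bw b≢q) b≢p
    (trans (≡-sym (kept c q b≢q)) (trans (≡-sym eq) (updated c q)))
  ... | no a≢q   | yes refl = λ eq → free (∈conf⁺ w bw aw a≢q) a≢p
    (trans (≡-sym (kept c q a≢q)) (trans eq (updated c q)))
  ... | no a≢q   | no b≢q   = λ eq → good w a≢b aw bw a≢p a≢q b≢p b≢q
    (trans (≡-sym (kept c q a≢q)) (trans eq (kept c q b≢q)))

  finish : ∀ {c p k} → Good c p p → ¬ (∀ {s} → s ∈ conf p → c s ≢ k)
  finish {c} {p} {k} good free = ¬colourable (c [ p ↦ k ] , proper)
    where
    proper : IsInjectiveColoring G (D + 2) (c [ p ↦ k ])
    proper a b w a≢b aw bw with a ≟ p | b ≟ p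
    ... | yes refl | yes refl = ⊥-elim (a≢b refl)
    ... | yes refl | no b≢p   = λ eq → free (∈conf⁺ w aw bw b≢p)
      (trans (≡-sym (kept c p b≢p)) (trans (≡-sym eq) (updated c p)))
    ... | no a≢p   | yes refl = λ eq → free (∈conf⁺ w bw aw a≢p)
      (trans (≡-sym (kept c p a≢p)) (trans eq (updated c p)))
    ... | no a≢p   | no b≢p   = λ eq → good w a≢b aw bw a≢p a≢p b≢p b≢p
      (trans (≡-sym (kept c p a≢p)) (trans eq (kept c p b≢p)))

  seen? : ∀ (c : Colouring) p l k → Dec (∃[ s ] s ∈ l × s ≢ p × c s ≡ k)
  seen? c p l k = map′ (λ any → let (s , s∈ , q) = find any in s , s∈ , q)
    (λ (s , s∈ , q) → lose s∈ q) (Any.any? (λ s → ¬? (s ≟ p) ×-dec (c s ≟ k)) l)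

  ¬easy-good : ∀ {c p} → Good c p p → ¬ Easy p
  ¬easy-good {c} {p} good easy =
    let (k , unseen) = ¬∀⟶∃¬ _ _ (seen? c p (conf p)) λ all →
          <⇒≱ (subst (length (conf p) <_) (≡-sym (+-suc D 1)) (s≤s easy))
            (covers⇒≤ (conf p) c λ k → let (s , s∈ , _ , cs≡k) = all k in s , s∈ , cs≡k)
    in finish good λ {s} s∈ cs≡k → unseen (s , s∈ , proj₁ (∈conf⁻ s∈) , cs≡k)

  -- A colour missing around `q` could be given to `q`, and then the easy vertex `p` could be
  -- coloured last. The colour of `p` itself is disregarded, hence `s ≢ p`.
  cover : ∀ {c p q} → Easy p → Good c p q → ∀ k → ∃[ s ] s ∈ conf q × s ≢ p × c s ≡ k
  cover {c} {p} {q} easy good k with seen? c p (conf q) k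
  ... | yes seen  = seen
  ... | no unseen = ⊥-elim (¬easy-good
    (fill good λ {s} s∈ s≢p cs≡k → unseen (s , s∈ , s≢p , cs≡k)) easy)

  ¬easy-hole : ∀ {c p q} → Easy p → Good c p q → ¬ Easy q
  ¬easy-hole {c} {q = q} easy good easyq =
    <⇒≱ (subst (length (conf q) <_) (≡-sym (+-suc D 1)) (s≤s easyq))
      (covers⇒≤ (conf q) c λ k → let (s , s∈ , _ , cs≡k) = cover easy good k in s , s∈ , cs≡k)

  -- Every conflict lost with the edge has `u` or `v` as one of its two vertices, so it is enough to
  -- make both of them holes.
  delete-good : ∀ {u v} → u ~ v → ∃[ c ] Good c u v
  delete-good uv = let (c , inj) = deleted uv in c , λ w a≢b aw bw a≢u a≢v b≢u b≢v →
    inj _ _ w a≢b (deleteEdge⁺ G aw (a≢u ∘ proj₁) (a≢v ∘ proj₁))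
                  (deleteEdge⁺ G bw (b≢u ∘ proj₁) (b≢v ∘ proj₁))

  ¬easy-edge : ∀ {u v} → u ~ v → Easy u → ¬ Easy v
  ¬easy-edge uv easyu = ¬easy-hole easyu (proj₂ (delete-good uv))

  -- Delete the edge from a leaf `v` to its neighbour `w`. Conflicts of `w` through `v` would need a
  -- second neighbour of `v`, so only `v` becomes a hole, and it sees fewer than `D` vertices.
  deg≢1 : ∀ v → deg v ≢ 1
  deg≢1 v deg≡1 = leaf (N v) refl deg≡1
    where
    leaf : ∀ l → N v ≡ l → length l ≢ 1
    leaf (w ∷ []) Nv≡ refl = ¬easy-good good easy
      where
      v~⇒≡w : ∀ {x} → v ~ x → x ≡ w
      v~⇒≡w vx with subst (_ ∈_) Nv≡ (∈N⁺ vx)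
      ... | here x≡w = x≡w
      vw : v ~ w
      vw = ∈N⁻ (subst (w ∈_) (≡-sym Nv≡) (here refl))
      c = proj₁ (deleted vw)
      good : Good c v v
      good x a≢b ax bx a≢v _ b≢v _ = proj₂ (deleted vw) _ _ x a≢b
        (deleteEdge⁺ G ax (a≢v ∘ proj₁) λ { (refl , refl) → a≢b (≡-sym (v~⇒≡w (~-sym bx))) })
        (deleteEdge⁺ G bx (b≢v ∘ proj₁) λ { (refl , refl) → a≢b (v~⇒≡w (~-sym ax)) })
      easy : Easy v
      easy = ≤-trans (length-conf v) (subst (λ l → sum (map (λ w → deg w ∸ 1) l) ≤ D + 1) (≡-sym Nv≡)
        (+-mono-≤ (≤-trans (m∸n≤m (deg w) 1) (deg≤D w)) z≤n))

  -- Links: vertices of degree 2 seeing at most D + 2 others, viewed as edges between their neighbours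

  -- The field `four` keeps the conflict list of `e` within the number of colours: its length is at
  -- most 3 + (D - 1) = `D + 2`.
  record Link (x e y : V) : Set where
    constructor link
    field
      deg≡2 : deg e ≡ 2
      left  : x ~ e
      right : y ~ e
      x≢y   : x ≢ y
      four  : deg x ≡ 4 ⊎ deg y ≡ 4
  open Link

  link-sym : ∀ {x e y} → Link x e y → Link y e x
  link-sym (link d xe ye x≢y f) = link d ye xe (≢-sym x≢y) (swap f)

  neighbours : ∀ {x e y} → deg e ≡ 2 → x ~ e → y ~ e → x ≢ y →
    N e ≡ x ∷ y ∷ [] ⊎ N e ≡ y ∷ x ∷ []
  neighbours {x} {e} {y} d xe ye x≢y with two-elements d
  ... | p , q , eq with subst (x ∈_) eq (∈N⁺ (~-sym xe)) | subst (y ∈_) eq (∈N⁺ (~-sym ye))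
  ... | here refl         | here refl         = ⊥-elim (x≢y refl)
  ... | here refl         | there (here refl) = inj₁ eq
  ... | there (here refl) | here refl         = inj₂ eq
  ... | there (here refl) | there (here refl) = ⊥-elim (x≢y refl)

  link-neighbours : ∀ {x e y} → Link x e y → N e ≡ x ∷ y ∷ [] ⊎ N e ≡ y ∷ x ∷ []
  link-neighbours l = neighbours (deg≡2 l) (left l) (right l) (x≢y l)

  link-end : ∀ {x e y w} → Link x e y → w ~ e → w ≡ x ⊎ w ≡ y
  link-end {w = w} l we with link-neighbours l
  ... | inj₁ eq = decode (subst (w ∈_) eq (∈N⁺ (~-sym we)))
    where
    decode : ∀ {x y} → w ∈ x ∷ y ∷ [] → w ≡ x ⊎ w ≡ y
    decode (here w≡x)         = inj₁ w≡x
    decode (there (here w≡y)) = inj₂ w≡y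
  ... | inj₂ eq = decode (subst (w ∈_) eq (∈N⁺ (~-sym we)))
    where
    decode : ∀ {x y} → w ∈ y ∷ x ∷ [] → w ≡ x ⊎ w ≡ y
    decode (here w≡y)         = inj₂ w≡y
    decode (there (here w≡x)) = inj₁ w≡x

  other-end : ∀ {x e y w} → Link x e y → w ~ e → w ≢ x → w ≡ y
  other-end l we w≢x = [ (λ w≡x → ⊥-elim (w≢x w≡x)) , id ]′ (link-end l we)

  link-degrees : ∀ {a b} → a ≤ 4 → b ≤ D → (a ∸ 1) + (b ∸ 1) ≤ D + 2
  link-degrees {a} {b} a≤4 b≤D = begin
    (a ∸ 1) + (b ∸ 1)   ≤⟨ +-mono-≤ (∸-monoˡ-≤ 1 a≤4) (∸-monoˡ-≤ 1 b≤D) ⟩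
    2 + (1 + (D ∸ 1))   ≡⟨ cong (2 +_) (m+[n∸m]≡n (≤-trans (s≤s z≤n) 4≤D)) ⟩
    2 + D               ≡⟨ +-comm 2 D ⟩
    D + 2               ∎
    where open ≤-Reasoning

  conf-link : ∀ {x e y} → Link x e y → length (conf e) ≤ D + 2
  conf-link {x} {e} {y} l = ≤-trans (length-conf e) ([ bound (four l) , bound (swap (four l)) ]′ (link-neighbours l))
    where
    open ≤-Reasoning
    bound : ∀ {x y} → deg x ≡ 4 ⊎ deg y ≡ 4 → N e ≡ x ∷ y ∷ [] →
      sum (map (λ w → deg w ∸ 1) (N e)) ≤ D + 2
    bound {x} {y} (inj₁ dx≡4) eq rewrite eq | dx≡4 | +-identityʳ (deg y ∸ 1) =
      link-degrees ≤-refl (deg≤D y)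
    bound {x} {y} (inj₂ dy≡4) eq rewrite eq | dy≡4 | +-comm (deg x ∸ 1) 3 =
      link-degrees ≤-refl (deg≤D x)

  -- Walks along links, all of whose nodes satisfy P

  data Walk (P : V → Set) : V → V → Set where
    stop : ∀ {x} → P x → Walk P x x
    go   : ∀ {x e y z} → P x → Link x e y → Walk P y z → Walk P x z

  module _ {P : V → Set} where

    start : ∀ {x y} → Walk P x y → P x
    start (stop p)   = p
    start (go p _ _) = p

    infixr 5 _▷_
    _▷_ : ∀ {x y z} → Walk P x y → Walk P y z → Walk P x z
    stop _   ▷ w′ = w′
    go p l w ▷ w′ = go p l (w ▷ w′)

    reverse : ∀ {x y} → Walk P x y → Walk P y x
    reverse (stop p)   = stop p
    reverse (go p l w) = reverse w ▷ go (start w) (link-sym l) (stop p)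

    weaken : ∀ {Q : V → Set} {x y} → (∀ {z} → P z → Q z) → Walk P x y → Walk Q x y
    weaken f (stop p)   = stop (f p)
    weaken f (go p l w) = go (f p) l (weaken f w)

  -- The walk is cut at its first visit to `x` or `y`. Applied to a walk from the root, this finds
  -- the end of a link that is reached without passing the other.
  first-hit : ∀ {P : V → Set} {w x y} → x ≢ y → Walk P w x →
    Walk (λ z → P z × z ≢ y) w x ⊎ Walk (λ z → P z × z ≢ x) w y
  first-hit x≢y (stop p) = inj₁ (stop (p , x≢y))
  first-hit {w = w} {x} {y} x≢y (go p l wk) with w ≟ x | w ≟ y
  ... | yes refl | _        = inj₁ (stop (p , x≢y))
  ... | no _     | yes refl = inj₂ (stop (p , ≢-sym x≢y))
  ... | no w≢x   | no w≢y   = mapSum (go (p , w≢y) l) (go (p , w≢x) l) (first-hit x≢y wk)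

  -- The walk is kept only from its last visit to `a` onwards.
  last-exit : ∀ {P : V → Set} {a b} → a ≢ b → Walk P a b → ∃[ e ] ∃[ y ] Link a e y × Walk (λ z → P z × z ≢ a) y b
  last-exit {P} {a} {b} a≢b wk with scan wk
    where
    scan : ∀ {s} → Walk P s b → Walk (λ z → P z × z ≢ a) s b ⊎
      (∃[ e ] ∃[ y ] Link a e y × Walk (λ z → P z × z ≢ a) y b)
    scan (stop p) = inj₁ (stop (p , ≢-sym a≢b))
    scan {s} (go p l w) with scan w | s ≟ a
    ... | inj₂ exit | _        = inj₂ exit
    ... | inj₁ w′   | yes refl = inj₂ (_ , _ , l , w′)
    ... | inj₁ w′   | no s≢a   = inj₁ (go (p , s≢a) l w′)
  ... | inj₁ w    = ⊥-elim (proj₂ (start w) refl)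
  ... | inj₂ exit = exit

  Connected : V → V → Set
  Connected = Walk (const ⊤)

  _avoiding_⇝_ : V → V → V → Set
  x avoiding a ⇝ y = Walk (_≢ a) x y

  -- Moving a hole along links

  module Hole (v : V) (easy-v : Easy v) where

    -- Any link at `x` can be made the second hole, while the first stays at the easy vertex `v`.
    Holes : V → Set
    Holes x = ∀ {e y} → Link x e y → ∃[ c ] Good c v e

    module _ {x e y c} (l : Link x e y) (good : Good c v e) where

      private
        colours : ∀ k → ∃[ s ] s ∈ conf e × c s ≡ k
        colours k = let (s , s∈ , _ , cs≡k) = cover easy-v good k in s , s∈ , cs≡k

      hole-injective : ∀ {s t} → s ∈ conf e → t ∈ conf e → c s ≡ c t → s ≡ t
      hole-injective = covers⇒injective c (conf-link l) colours _≟_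

      v∉conf : ¬ v ∈ conf e
      v∉conf v∈ with ∈-∃++ v∈
      ... | l₁ , _ , eq = covers⇒critical c (conf-link l) l₁ eq λ k →
        let (s , s∈ , s≢v , cs≡k) = cover easy-v good k in
        s , ∈-drop-middle l₁ (subst (s ∈_) eq s∈) s≢v , cs≡k

      -- Only s has its colour among the vertices in conflict with e, so e may take that colour over.
      move : ∀ {s} → s ∈ conf e → Good (c [ e ↦ c s ]) v s
      move {s} s∈ {a} {b} w a≢b aw bw a≢v a≢s b≢v b≢s with a ≟ e | b ≟ e
      ... | yes refl | yes refl = ⊥-elim (a≢b refl)
      ... | yes refl | no b≢e = λ eq → b≢s (hole-injective (∈conf⁺ w aw bw b≢e) s∈
        (trans (≡-sym (kept c e b≢e)) (trans (≡-sym eq) (updated c e))))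
      ... | no a≢e | yes refl = λ eq → a≢s (hole-injective (∈conf⁺ w bw aw a≢e) s∈
        (trans (≡-sym (kept c e a≢e)) (trans eq (updated c e))))
      ... | no a≢e | no b≢e = λ eq → good w a≢b aw bw a≢v a≢e b≢v b≢e
        (trans (≡-sym (kept c e a≢e)) (trans eq (kept c e b≢e)))

      -- Such an `f` is listed in `conf e` twice, once through each end, whereas the entries must
      -- have pairwise distinct colours.
      no-parallel : ∀ {f} → f ≢ e → x ~ f → ¬ y ~ f
      no-parallel {f} f≢e xf yf = [ repeated xf yf , repeated yf xf ]′ (link-neighbours l)
        where
        repeated : ∀ {x y} → x ~ f → y ~ f → ¬ N e ≡ x ∷ y ∷ []
        repeated {x} {y} xf yf eq with ∈-∃++ (∈others⁺ f≢e xf)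
        ... | l₁ , l₂ , eq′ = covers⇒rainbow c (conf-link l) colours _≟_ l₁ {f}
          (trans (cong (concatMap (others e)) eq)
            (trans (cong (_++ others e y ++ []) eq′) (++-assoc l₁ (f ∷ l₂) _)))
          (∈-++⁺ʳ l₁ (∈-++⁺ʳ l₂ (∈-++⁺ˡ (∈others⁺ f≢e yf)))) refl

    holes-at : ∀ {x} → v ≡ x → Holes x
    holes-at refl l = delete-good (left l)

    -- The links `e` and `f` meet in `y`, so `f` is in conflict with the hole at `e` and can take it
    -- over.
    holes-step : ∀ {x e y} → Link x e y → Holes x → Holes y
    holes-step {e = e} l holes {f} m with f ≟ e
    ... | yes refl = holes l
    ... | no f≢e   = _ , move l (proj₂ (holes l)) (∈conf⁺ _ (~-sym (right l)) (~-sym (left m)) f≢e)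

    holes-walk : ∀ {P x y} → Walk P x y → Holes x → Holes y
    holes-walk (stop _)   holes = holes
    holes-walk (go _ l w) holes = holes-walk w (holes-step l holes)

    -- Two colourings reached by different routes of the hole. They share the hole `h`, and around
    -- it only the colours of `a` and `b` can disagree.
    record Pair (a b h : V) : Set where
      field
        c₁ c₂  : Colouring
        good₁  : Good c₁ v h
        good₂  : Good c₂ v h
        agree  : ∀ {s} → s ≢ a → s ≢ b → s ≢ h → c₁ s ≡ c₂ s
        differ : c₁ a ≢ c₂ a
        a≢h    : a ≢ h
    open Pair

    -- The vertex `t` has the same colour in both colourings, so the old hole `h` receives one
    -- common colour.
    pair-move : ∀ {a b x h y t} → Pair a b h → Link x h y → t ∈ conf h → t ≢ a → t ≢ b → Pair a b t
    pair-move {a} {b} {h = h} {t = t} P l t∈ t≢a t≢b = record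
      { c₁ = c₁ P [ h ↦ c₁ P t ] ; c₂ = c₂ P [ h ↦ c₂ P t ]
      ; good₁ = move l (good₁ P) t∈ ; good₂ = move l (good₂ P) t∈
      ; agree = agree′
      ; differ = λ eq → differ P
          (trans (≡-sym (kept (c₁ P) h (a≢h P))) (trans eq (kept (c₂ P) h (a≢h P))))
      ; a≢h = ≢-sym t≢a }
      where
      agree′ : ∀ {s} → s ≢ a → s ≢ b → s ≢ t → (c₁ P [ h ↦ c₁ P t ]) s ≡ (c₂ P [ h ↦ c₂ P t ]) s
      agree′ {s} s≢a s≢b s≢t with s ≟ h
      ... | yes refl = trans (updated (c₁ P) h)
        (trans (agree P t≢a t≢b (proj₁ (∈conf⁻ t∈))) (≡-sym (updated (c₂ P) h)))
      ... | no s≢h = trans (kept (c₁ P) h s≢h) (trans (agree P s≢a s≢b s≢h) (≡-sym (kept (c₂ P) h s≢h)))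

    -- In `c₂` the colour `c₁ a` must still occur around the hole. Without `b` there, it occurs at a
    -- vertex on which the colourings agree, so `c₁` would use it twice around `h`.
    pair-end : ∀ {a b x h y} → Pair a b h → Link x h y → a ∈ conf h → ¬ ¬ b ∈ conf h
    pair-end {a} P l a∈ b∉ =
      let (s , s∈ , _ , c₂s≡c₁a) = cover easy-v (good₂ P) (c₁ P a)
          s≢a = λ s≡a → differ P (trans (≡-sym c₂s≡c₁a) (cong (c₂ P) s≡a))
          s≢b = λ s≡b → b∉ (subst (_∈ _) s≡b s∈)
      in s≢a (hole-injective l (good₁ P) s∈ a∈ (trans (agree P s≢a s≢b (proj₁ (∈conf⁻ s∈))) c₂s≡c₁a))

    adjacent : ∀ {x e y f z} → Link x e y → Link x f z → f ≢ e → f ∈ conf e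
    adjacent l m f≢e = ∈conf⁺ _ (~-sym (left l)) (~-sym (left m)) f≢e

    -- Moving the hole around h → b → a → h exchanges the colours of a and b.
    exchange : ∀ {x a b h y z w} → Link x h y → Link x a z → Link x b w →
      a ≢ h → b ≢ h → a ≢ b → Holes x → Pair a b h
    exchange {x} {a} {b} {h} lh la lb a≢h b≢h a≢b holes = record
      { c₁ = c ; c₂ = c‴ ; good₁ = good ; good₂ = move la good″ (adjacent la lh (≢-sym a≢h))
      ; agree = λ s≢a s≢b s≢h → ≡-sym
          (trans (kept c″ a s≢a) (trans (kept c′ b s≢b) (kept c h s≢h)))
      -- At the end `a` has the old colour of `b`; in `c` these differ, because `a` and `b` share
      -- the neighbour `x` and neither is a hole.
      ; differ = λ ca≡c‴a → good x a≢b (~-sym (left la)) (~-sym (left lb)) (≢v la a≢h) a≢h (≢v lb b≢h) b≢h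
          (trans ca≡c‴a (trans (updated c″ a) (trans (kept c′ b (≢-sym b≢h)) (updated c h))))
      ; a≢h = a≢h }
      where
      c = proj₁ (holes lh)
      good = proj₂ (holes lh)
      c′ = c [ h ↦ c b ]
      c″ = c′ [ b ↦ c′ a ]
      c‴ = c″ [ a ↦ c″ h ]
      good″ : Good c″ v a
      good″ = move lb (move lh good (adjacent lh lb b≢h)) (adjacent lb la a≢b)
      ≢v : ∀ {s z} → Link x s z → s ≢ h → s ≢ v
      ≢v ls s≢h refl = v∉conf lh good (adjacent lh ls s≢h)

    misses : ∀ {x w e y} → Link w e y → w ≢ x → y ≢ x → ¬ x ~ e
    misses l w≢x y≢x xe = [ (λ x≡w → w≢x (≡-sym x≡w)) , (λ x≡y → y≢x (≡-sym x≡y)) ]′ (link-end l xe)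

    ≢-miss : ∀ {x a t} → x ~ a → ¬ x ~ t → t ≢ a
    ≢-miss xa ¬xt refl = ¬xt xa

    -- Links on a walk avoiding `x` are not adjacent to `x`, so the hole never passes through `a` or
    -- `b`. A repeated link leaves the hole in place.
    pair-walk : ∀ {x a b w p z y} → x ~ a → x ~ b → Link w p z → w ≢ x → Pair a b p →
      z avoiding x ⇝ y → ∃[ u ] ∃[ t ] Link u t y × u ≢ x × Pair a b t
    pair-walk xa xb lp w≢x P (stop _) = _ , _ , lp , w≢x , P
    pair-walk {p = p} xa xb lp w≢x P (go {e = t} z≢x lt wk) with t ≟ p
    ... | yes refl = pair-walk xa xb lt z≢x P wk
    ... | no t≢p   = pair-walk xa xb lt z≢x
      (pair-move P lp (adjacent (link-sym lp) lt t≢p) (≢-miss xa ¬xt) (≢-miss xb ¬xt)) wk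
      where ¬xt = misses lt z≢x (start wk)

    -- Exchange the colours of e and f through e′, and walk the hole from e′ to a link t at y. At t only
    -- the colour of e has changed, although every colour must still occur there. If f meets t, then
    -- e, f and t form a triangle, and one exchanges e and e′ before moving the hole from f to t instead.
    no-three-links : ∀ {x e y e′ y′ f z} → Link x e y → Link x e′ y′ → Link x f z →
      e ≢ e′ → f ≢ e → f ≢ e′ → Holes x → ¬ y′ avoiding x ⇝ y
    no-three-links le le′ lf e≢e′ f≢e f≢e′ holes (stop _) =
      no-parallel le (proj₂ (holes le)) (≢-sym e≢e′) (left le′) (right le′)
    no-three-links {x} {e} {y} {e′} {y′} {f} {z} le le′ lf e≢e′ f≢e f≢e′ holes (go {e = t₁} y′≢x l₁ wk)
      with pair-walk (left le) (left lf) l₁ y′≢x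
        (pair-move (exchange le′ le lf e≢e′ f≢e′ (≢-sym f≢e) holes) le′
          (adjacent (link-sym le′) l₁ (≢-miss (left le′) ¬xt₁)) (≢-miss (left le) ¬xt₁) (≢-miss (left lf) ¬xt₁)) wk
      where ¬xt₁ = misses l₁ y′≢x (start wk)
    ... | u , t , lt , u≢x , P = pair-end P lt e∈ f∉
      where
      y≢x : y ≢ x
      y≢x = ≢-sym (x≢y le)
      ¬xt : ¬ x ~ t
      ¬xt = misses lt u≢x y≢x
      e∈ : e ∈ conf t
      e∈ = adjacent (link-sym lt) (link-sym le) (≢-sym (≢-miss (left le) ¬xt))
      -- A shared neighbour is an end of both links. As `z` is not `u`, it would make `x` an end of
      -- `t`, or make the two links at `x` parallel.
      apart : ∀ {f z} → Link x f z → f ≢ e → z ≢ u → ¬ f ∈ conf t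
      apart lf f≢e z≢u f∈ with ∈conf⁻ f∈
      ... | _ , s , ts , fs with link-end lt (~-sym ts) | link-end lf (~-sym fs)
      ... | inj₁ refl | inj₁ refl = u≢x refl
      ... | inj₁ refl | inj₂ refl = z≢u refl
      ... | inj₂ refl | inj₁ refl = y≢x refl
      ... | inj₂ refl | inj₂ refl = no-parallel le (proj₂ (holes le)) f≢e (left lf) (right lf)
      f∉ : ¬ f ∈ conf t
      f∉ f∈ with z ≟ u
      ... | no z≢u = apart lf f≢e z≢u f∈
      ... | yes refl = pair-end
        (pair-move (exchange lf le le′ (≢-sym f≢e) (≢-sym f≢e′) e≢e′ holes) lf
          (adjacent (link-sym lf) lt (≢-miss (left lf) ¬xt)) (≢-miss (left le) ¬xt) (≢-miss (left le′) ¬xt))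
        lt e∈ (apart le′ (≢-sym e≢e′) λ { refl →
          no-parallel lf (proj₂ (holes lf)) (≢-sym f≢e′) (left le′) (right le′) })

    -- Cycles of links

    record Cycle (x : V) : Set where
      constructor cycle
      field
        {e e′ y y′} : V
        l  : Link x e y
        l′ : Link x e′ y′
        e≢e′ : e ≢ e′
        around : y avoiding x ⇝ y′

    flip : ∀ {x} → Cycle x → Cycle x
    flip (cycle l l′ e≢e′ w) = cycle l′ l (≢-sym e≢e′) (reverse w)

    -- The cycle is re-based at its neighbour `y′`: one link goes back to `x`, the other is the last
    -- exit from `y′` on the way to `y`, which makes the remaining walk avoid `y′`.
    turn : ∀ {x} (C : Cycle x) → Holes x → Cycle (Cycle.y′ C)
    turn {x} (cycle {e} {e′} {y} {y′} l l′ e≢e′ w) holes =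
      let (t , z , lt , wk) = last-exit y′≢y (reverse w)
      in cycle (link-sym l′) lt (≢-sym (≢-miss (left l′) (misses lt (≢-sym (x≢y l′)) (proj₁ (start wk)))))
           (go (x≢y l′) l (weaken proj₂ (reverse wk)))
      where
      y′≢y : y′ ≢ y
      y′≢y refl = no-parallel l (proj₂ (holes l)) (≢-sym e≢e′) (left l′) (right l′)

    -- A link at `x` other than the two of the cycle is excluded by `no-three-links`. So any step
    -- from `x` follows the cycle, which can be turned along with it.
    cycle-step : ∀ {x g z} → Link x g z → Holes x → Cycle x → Cycle z
    cycle-step {x} {g} lg holes C@(cycle {e} {e′} l l′ e≢e′ w) with g ≟ e | g ≟ e′
    ... | _        | yes refl = subst Cycle (≡-sym (other-end l′ (right lg) (≢-sym (x≢y lg)))) (turn C holes)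
    ... | yes refl | no _     = subst Cycle (≡-sym (other-end l (right lg) (≢-sym (x≢y lg)))) (turn (flip C) holes)
    ... | no g≢e   | no g≢e′  = ⊥-elim (no-three-links l l′ lg e≢e′ g≢e g≢e′ holes (reverse w))

    cycle-walk : ∀ {P x z} → Walk P x z → Holes x → Cycle x → Cycle z
    cycle-walk (stop _)    holes C = C
    cycle-walk (go _ l wk) holes C = cycle-walk wk (holes-step l holes) (cycle-step l holes C)

    -- One of the three links is not among the two that the cycle uses at `v`.
    no-cycle : ∀ {e f g x y z} → Link v e x → Link v f y → Link v g z →
      e ≢ f → e ≢ g → f ≢ g → ¬ Cycle v
    no-cycle {e} {f} {g} le lf lg e≢f e≢g f≢g (cycle {p} {q} lp lq p≢q w)
      with e ≟ p | e ≟ q | f ≟ p | f ≟ q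
    ... | no e≢p   | no e≢q   | _        | _        = no-three-links lp lq le p≢q e≢p e≢q (holes-at refl) (reverse w)
    ... | _        | _        | no f≢p   | no f≢q   = no-three-links lp lq lf p≢q f≢p f≢q (holes-at refl) (reverse w)
    ... | yes refl | yes refl | _        | _        = p≢q refl
    ... | _        | _        | yes refl | yes refl = p≢q refl
    ... | yes refl | _        | yes refl | _        = e≢f refl
    ... | _        | yes refl | _        | yes refl = e≢f refl
    ... | yes refl | _        | _        | yes refl =
      no-three-links lp lq lg p≢q (≢-sym e≢g) (≢-sym f≢g) (holes-at refl) (reverse w)
    ... | _        | yes refl | yes refl | _        =
      no-three-links lp lq lg p≢q (≢-sym f≢g) (≢-sym e≢g) (holes-at refl) (reverse w)

  -- Heavy vertices: the neighbours have degrees 2, 2, 2, 2 or 2, 2, 2, 3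

  data DegreeView : ℕ → Set where
    two   : DegreeView 2
    three : DegreeView 3
    large : ∀ k → DegreeView (4 + k)

  degreeView : ∀ {u v} → u ~ v → DegreeView (deg u)
  degreeView {u} {v} uv = view (deg u) refl
    where
    view : ∀ d → deg u ≡ d → DegreeView d
    view 0 eq = ⊥-elim (nonempty (∈N⁺ uv) eq)
      where
      nonempty : ∀ {l : List V} → v ∈ l → length l ≢ 0
      nonempty (here _) ()
      nonempty (there _) ()
    view 1 eq = ⊥-elim (deg≢1 u eq)
    view 2 _  = two
    view 3 _  = three
    view (suc (suc (suc (suc k)))) _ = large k

  -- A 4-vertex can spare 5 · 4 - 14 = 6; from 7 on, the ordinary payments overdraw it.
  Heavy : V → Set
  Heavy v = deg v ≡ 4 × T (7 ≤ᵇ sum (map (weight ∘ deg) (N v)))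

  record ThreeTwos (v : V) : Set where
    constructor threeTwos
    field
      {a b c} : V
      va : v ~ a
      vb : v ~ b
      vc : v ~ c
      deg-a : deg a ≡ 2
      deg-b : deg b ≡ 2
      deg-c : deg c ≡ 2
      a≢b : a ≢ b
      a≢c : a ≢ c
      b≢c : b ≢ c

  -- Four weights of at most 2 reach 7 only if at most one of them is 1 and none is 0. The bound 5 =
  -- 1 + 1 + 1 + 2 is at most `D + 1`, so heavy vertices are easy.
  heavy-degrees : ∀ {a b c d} → DegreeView a → DegreeView b → DegreeView c → DegreeView d →
    T (7 ≤ᵇ weight a + (weight b + (weight c + (weight d + 0)))) →
    (a ∸ 1) + ((b ∸ 1) + ((c ∸ 1) + ((d ∸ 1) + 0))) ≤ 5 ×
    ((a ≡ 2 × b ≡ 2 × c ≡ 2) ⊎ (a ≡ 2 × b ≡ 2 × d ≡ 2) ⊎ (a ≡ 2 × c ≡ 2 × d ≡ 2) ⊎ (b ≡ 2 × c ≡ 2 × d ≡ 2))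
  heavy-degrees {a} {b} {c} {d} = λ where
      two   two   two   two   _ → n≤1+n 4 , inj₁ (refl , refl , refl)
      two   two   two   three _ → ≤-refl , inj₁ (refl , refl , refl)
      two   two   three two   _ → ≤-refl , inj₂ (inj₁ (refl , refl , refl))
      two   three two   two   _ → ≤-refl , inj₂ (inj₂ (inj₁ (refl , refl , refl)))
      three two   two   two   _ → ≤-refl , inj₂ (inj₂ (inj₂ (refl , refl , refl)))
      (large _) _ _ _         h → impossible 0 2 2 2 z≤n (≤2 b) (≤2 c) (≤2 d) tt h
      _ (large _) _ _         h → impossible 2 0 2 2 (≤2 a) z≤n (≤2 c) (≤2 d) tt h
      _ _ (large _) _         h → impossible 2 2 0 2 (≤2 a) (≤2 b) z≤n (≤2 d) tt h
      _ _ _ (large _)         h → impossible 2 2 2 0 (≤2 a) (≤2 b) (≤2 c) z≤n tt h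
      three three _ _         h → impossible 1 1 2 2 ≤-refl ≤-refl (≤2 c) (≤2 d) tt h
      three _ three _         h → impossible 1 2 1 2 ≤-refl (≤2 b) ≤-refl (≤2 d) tt h
      three _ _ three         h → impossible 1 2 2 1 ≤-refl (≤2 b) (≤2 c) ≤-refl tt h
      _ three three _         h → impossible 2 1 1 2 (≤2 a) ≤-refl ≤-refl (≤2 d) tt h
      _ three _ three         h → impossible 2 1 2 1 (≤2 a) ≤-refl (≤2 c) ≤-refl tt h
      _ _ three three         h → impossible 2 2 1 1 (≤2 a) (≤2 b) ≤-refl ≤-refl tt h
    where
    ≤2 = weight≤2
    impossible : ∀ {A : Set} {a b c d} a′ b′ c′ d′ → a ≤ a′ → b ≤ b′ → c ≤ c′ → d ≤ d′ →
      T (a′ + (b′ + (c′ + (d′ + 0))) ≤ᵇ 6) → T (7 ≤ᵇ a + (b + (c + (d + 0)))) → A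
    impossible _ _ _ _ a≤ b≤ c≤ d≤ ≤6 7≤ = ⊥-elim (<⇒≱ (≤ᵇ⇒≤ 7 _ 7≤)
      (≤-trans (+-mono-≤ a≤ (+-mono-≤ b≤ (+-mono-≤ c≤ (+-mono-≤ d≤ z≤n)))) (≤ᵇ⇒≤ _ 6 ≤6)))

  heavy-shape : ∀ {v} → Heavy v → Easy v × ThreeTwos v
  heavy-shape {v} (d≡4 , heavy) with four-elements d≡4
  ... | a , b , c , d , eq = shape (subst Unique eq (N! v))
    (heavy-degrees (degreeView (~-sym va)) (degreeView (~-sym vb)) (degreeView (~-sym vc)) (degreeView (~-sym vd))
      (subst (λ l → T (7 ≤ᵇ sum (map (weight ∘ deg) l))) eq heavy))
    where
    member : ∀ {u} → u ∈ a ∷ b ∷ c ∷ d ∷ [] → v ~ u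
    member u∈ = ∈N⁻ (subst (_ ∈_) (≡-sym eq) u∈)
    va = member (here refl)
    vb = member (there (here refl))
    vc = member (there (there (here refl)))
    vd = member (there (there (there (here refl))))
    shape : Unique (a ∷ b ∷ c ∷ d ∷ []) → _ → Easy v × ThreeTwos v
    shape ((a≢b ∷ a≢c ∷ a≢d ∷ _) ∷ (b≢c ∷ b≢d ∷ _) ∷ (c≢d ∷ _) ∷ _) (≤5 , twos) = easy , choose twos
      where
      easy : Easy v
      easy = ≤-trans (length-conf v) (≤-trans
        (subst (λ l → sum (map (λ w → deg w ∸ 1) l) ≤ 5) (≡-sym eq) ≤5) (+-monoˡ-≤ 1 4≤D))
      choose : _ → ThreeTwos v
      choose (inj₁ (p , q , r))               = threeTwos va vb vc p q r a≢b a≢c b≢c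
      choose (inj₂ (inj₁ (p , q , r)))        = threeTwos va vb vd p q r a≢b a≢d b≢d
      choose (inj₂ (inj₂ (inj₁ (p , q , r)))) = threeTwos va vc vd p q r a≢c a≢d c≢d
      choose (inj₂ (inj₂ (inj₂ (p , q , r)))) = threeTwos vb vc vd p q r b≢c b≢d c≢d

  heavy-easy : ∀ {v} → Heavy v → Easy v
  heavy-easy = proj₁ ∘ heavy-shape

  second-neighbour : ∀ {x e} → x ~ e → deg e ≡ 2 → ∃[ y ] x ≢ y × y ~ e
  second-neighbour {x} {e} xe d with two-elements d
  ... | p , q , eq with subst Unique eq (N! e) | subst (x ∈_) eq (∈N⁺ (~-sym xe))
  ... | (p≢q ∷ []) ∷ _ | here refl         = q , p≢q , ~-sym (∈N⁻ (subst (q ∈_) (≡-sym eq) (there (here refl))))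
  ... | (p≢q ∷ []) ∷ _ | there (here refl) = p , ≢-sym p≢q , ~-sym (∈N⁻ (subst (p ∈_) (≡-sym eq) (here refl)))

  link-from : ∀ {x e} → deg x ≡ 4 → x ~ e → deg e ≡ 2 → ∃[ y ] Link x e y
  link-from dx xe de = let (y , x≢y , ye) = second-neighbour xe de in y , link de xe ye x≢y (inj₁ dx)

  -- The components of links containing a heavy vertex are trees, rooted at their first heavy vertex

  -- Minimality of the index makes the root of a component unique.
  Root : V → Set
  Root v = Heavy v × (∀ {u} → Heavy u → Connected v u → toℕ v ≤ toℕ u)

  Core : V → Set
  Core x = ∃[ v ] Root v × Connected v x

  connect : ∀ {P x y} → Walk P x y → Connected x y
  connect = weaken (const tt)

  extend : ∀ {P x y e z} → Walk P x y → Link y e z → Connected x z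
  extend w l = connect w ▷ go tt l (stop tt)

  -- Descent on the index. The double negation appears because it is not decided whether a smaller
  -- heavy vertex is connected to `v`.
  heavy-core : ∀ {v} → Heavy v → ¬ ¬ Core v
  heavy-core {v} = descend v (<-wellFounded (toℕ v))
    where
    descend : ∀ v → Acc _<_ (toℕ v) → Heavy v → ¬ ¬ Core v
    descend v (acc smaller) heavy ¬core = ¬core (v , (heavy , first) , stop tt)
      where
      first : ∀ {u} → Heavy u → Connected v u → toℕ v ≤ toℕ u
      first {u} heavy-u w = ≮⇒≥ λ u<v → descend u (smaller u<v) heavy-u
        λ (r , root , w′) → ¬core (r , root , w′ ▷ reverse w)

  core-step : ∀ {x e y} → Core x → Link x e y → Core y
  core-step (v , root , w) l = v , root , extend w l

  -- The hole can be carried from the root to `e`, and a hole is never easy.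
  core-link-¬easy : ∀ {x e y} → Core x → Link x e y → ¬ Easy e
  core-link-¬easy (v , (heavy , _) , w) l =
    ¬easy-hole (heavy-easy heavy) (proj₂ (holes-walk w (holes-at refl) l))
    where open Hole v (heavy-easy heavy)

  -- The link e leads from x towards the root.
  Up : V → V → Set
  Up e x = ∃[ v ] ∃[ y ] Root v × Link x e y × v avoiding x ⇝ y

  up-somewhere : ∀ {x e y} → Core x → Link x e y → Up e x ⊎ Up e y
  up-somewhere (v , root , w) l = swap (mapSum
    (λ w → v , _ , root , link-sym l , weaken proj₂ w)
    (λ w → v , _ , root , l , weaken proj₂ w)
    (first-hit (x≢y l) w))

  roots-equal : ∀ {v u} → Root v → Root u → Connected v u → v ≡ u
  roots-equal (heavy-v , first-v) (heavy-u , first-u) w =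
    toℕ-injective (≤-antisym (first-v heavy-u w) (first-u heavy-v (reverse w)))

  -- Two upward links, with their walks from the root, close a cycle at `x`. Carried to the root, it
  -- meets a vertex with three links, which `no-cycle` forbids.
  up-unique : ∀ {e f x} → Up e x → Up f x → e ≡ f
  up-unique {e} {f} {x} (v , y , root@(heavy , _) , le , w) (v′ , z , root′ , lf , w′)
    with e ≟ f | roots-equal root root′ (extend w (link-sym le) ▷ reverse (extend w′ (link-sym lf)))
  ... | yes e≡f | _    = e≡f
  ... | no e≢f  | refl = ⊥-elim (contra (proj₂ (heavy-shape heavy)))
    where
    open Hole v (heavy-easy heavy)
    v⇝x = extend w (link-sym le)
    cycle-v : Cycle v
    cycle-v = cycle-walk (reverse v⇝x) (holes-walk v⇝x (holes-at refl)) (cycle le lf e≢f (reverse w ▷ w′))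
    contra : ¬ ThreeTwos v
    contra (threeTwos va vb vc da db dc a≢b a≢c b≢c) = no-cycle
      (proj₂ (link-from (proj₁ heavy) va da)) (proj₂ (link-from (proj₁ heavy) vb db))
      (proj₂ (link-from (proj₁ heavy) vc dc)) a≢b a≢c b≢c cycle-v

  -- Discharging, in units of 1/5: v starts with 5 deg v − 14

  easy-2-vertex : ∀ {x e} → deg e ≡ 2 → x ~ e → deg x ≤ 3 → Easy e
  easy-2-vertex {x} {e} de xe dx≤3 =
    let (y , x≢y , ye) = second-neighbour xe de
    in ≤-trans (length-conf e) ([ bound , (λ eq → subst (_≤ D + 1) (reorder eq) (bound refl)) ]′
         (neighbours de xe ye x≢y))
    where
    open ≤-Reasoning
    total : List V → ℕ
    total l = sum (map (λ w → deg w ∸ 1) l)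
    reorder : ∀ {y l} → l ≡ y ∷ x ∷ [] → total (x ∷ y ∷ []) ≡ total l
    reorder {y} refl rewrite +-identityʳ (deg y ∸ 1) | +-identityʳ (deg x ∸ 1) = +-comm (deg x ∸ 1) _
    bound : ∀ {y l} → l ≡ x ∷ y ∷ [] → total l ≤ D + 1
    bound {y} refl = begin
      (deg x ∸ 1) + ((deg y ∸ 1) + 0) ≡⟨ cong ((deg x ∸ 1) +_) (+-identityʳ _) ⟩
      (deg x ∸ 1) + (deg y ∸ 1)       ≤⟨ +-mono-≤ (∸-monoˡ-≤ 1 dx≤3) (∸-monoˡ-≤ 1 (deg≤D y)) ⟩
      1 + (1 + (D ∸ 1))               ≡⟨ cong (1 +_) (m+[n∸m]≡n (≤-trans (s≤s z≤n) 4≤D)) ⟩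
      1 + D                           ≡⟨ +-comm 1 D ⟩
      D + 1                           ∎

  ¬2-2-edge : ∀ {u v} → u ~ v → deg u ≡ 2 → deg v ≢ 2
  ¬2-2-edge uv du dv = ¬easy-edge uv (easy-2-vertex du (~-sym uv) (subst (_≤ 3) (≡-sym dv) (n≤1+n 2)))
                                     (easy-2-vertex dv uv (subst (_≤ 3) (≡-sym du) (n≤1+n 2)))

  -- What `x` pays to its neighbour `u`: the toll to a 2-vertex, and 1 to a 3-vertex if `x` has
  -- degree at least 4.
  amount : (deg-u deg-x toll : ℕ) → ℕ
  amount 2 _                             t = t
  amount 3 (suc (suc (suc (suc _))))     _ = 1
  amount _ _                             _ = 0

  amount-≤ : ∀ du dx {t b} → 1 ≤ b → (du ≡ 2 → t ≤ b) → amount du dx t ≤ b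
  amount-≤ 0 _ _ _ = z≤n
  amount-≤ 1 _ _ _ = z≤n
  amount-≤ 2 _ _ t≤b = t≤b refl
  amount-≤ 3 0 _ _ = z≤n
  amount-≤ 3 1 _ _ = z≤n
  amount-≤ 3 2 _ _ = z≤n
  amount-≤ 3 3 _ _ = z≤n
  amount-≤ 3 (suc (suc (suc (suc _)))) 1≤b _ = 1≤b
  amount-≤ (suc (suc (suc (suc _)))) _ _ _ = z≤n

  amount-weight : ∀ d k → amount d (4 + k) 2 ≡ weight d
  amount-weight 0 _ = refl
  amount-weight 1 _ = refl
  amount-weight 2 _ = refl
  amount-weight 3 _ = refl
  amount-weight (suc (suc (suc (suc _)))) _ = refl

  amount-2-2 : ∀ {d t} → d ≢ 2 → amount d 2 t ≡ 0
  amount-2-2 {0} _ = refl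
  amount-2-2 {1} _ = refl
  amount-2-2 {2} d≢2 = ⊥-elim (d≢2 refl)
  amount-2-2 {3} _ = refl
  amount-2-2 {suc (suc (suc (suc _)))} _ = refl

  amount-3-3 : ∀ d {t} → (d ≡ 2 → t ≡ 2) → amount d 3 t ≡ amount d 3 2
  amount-3-3 0 _ = refl
  amount-3-3 1 _ = refl
  amount-3-3 2 t≡2 = t≡2 refl
  amount-3-3 3 _ = refl
  amount-3-3 (suc (suc (suc (suc _)))) _ = refl

  positive : ℕ → ℕ
  positive 0       = 0
  positive (suc _) = 1

  module Discharge (core? : ∀ x → Dec (Core x)) (linked? : ∀ x e → Dec (∃[ y ] Link x e y))
    (up? : ∀ e x → Dec (Up e x)) where

    -- A 2-vertex e needs 4. In a core tree it gets 3 from the end further from the root and 1 from the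
    -- other, so that a 4-vertex with a single upward link gives at most 3 + 1 + 1 + 1.
    toll : V → V → ℕ
    toll x e with core? x | linked? x e | up? e x
    ... | yes _ | yes _ | yes _ = 3
    ... | yes _ | yes _ | no _  = 1
    ... | yes _ | no _  | _     = 2
    ... | no _  | _     | _     = 2

    pay : V → V → ℕ
    pay x u = amount (deg u) (deg x) (toll x u)

    toll≤3 : ∀ x e → toll x e ≤ 3
    toll≤3 x e with core? x | linked? x e | up? e x
    ... | yes _ | yes _ | yes _ = ≤-refl
    ... | yes _ | yes _ | no _  = s≤s z≤n
    ... | yes _ | no _  | _     = n≤1+n 2
    ... | no _  | _     | _     = n≤1+n 2

    1≤toll : ∀ x e → 1 ≤ toll x e
    1≤toll x e with core? x | linked? x e | up? e x
    ... | yes _ | yes _ | yes _ = s≤s z≤n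
    ... | yes _ | yes _ | no _  = s≤s z≤n
    ... | yes _ | no _  | _     = s≤s z≤n
    ... | no _  | _     | _     = s≤s z≤n

    toll-¬up : ∀ {x e} → ¬ Up e x → toll x e ≤ 2
    toll-¬up {x} {e} ¬up with core? x | linked? x e | up? e x
    ... | yes _ | yes _ | yes up = ⊥-elim (¬up up)
    ... | yes _ | yes _ | no _   = s≤s z≤n
    ... | yes _ | no _  | _      = ≤-refl
    ... | no _  | _     | _      = ≤-refl

    toll-down : ∀ {x e y} → Core x → Link x e y → ¬ Up e x → toll x e ≡ 1
    toll-down {x} {e} core l ¬up with core? x | linked? x e | up? e x
    ... | yes _ | yes _ | yes up = ⊥-elim (¬up up)
    ... | yes _ | yes _ | no _   = refl
    ... | yes _ | no ¬l | _      = ⊥-elim (¬l (_ , l))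
    ... | no ¬c | _     | _      = ⊥-elim (¬c core)

    toll-up : ∀ {x e y} → Core x → Link x e y → Up e x → toll x e ≡ 3
    toll-up {x} {e} core l up with core? x | linked? x e | up? e x
    ... | yes _ | yes _ | yes _  = refl
    ... | yes _ | yes _ | no ¬up = ⊥-elim (¬up up)
    ... | yes _ | no ¬l | _      = ⊥-elim (¬l (_ , l))
    ... | no ¬c | _     | _      = ⊥-elim (¬c core)

    toll-outside : ∀ {x e} → ¬ (Core x × ∃[ y ] Link x e y) → toll x e ≡ 2
    toll-outside {x} {e} out with core? x | linked? x e | up? e x
    ... | yes c | yes l | _ = ⊥-elim (out (c , l))
    ... | yes _ | no _  | _ = refl
    ... | no _  | _     | _ = refl

    link-tolls : ∀ {x e y} → Core x → Link x e y → 4 ≤ toll x e + toll y e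
    link-tolls {x} {e} {y} core l = [ up-x , up-y ]′ (up-somewhere core l)
      where
      up-x : Up e x → 4 ≤ toll x e + toll y e
      up-x up = +-mono-≤ (≤-reflexive (≡-sym (toll-up core l up))) (1≤toll y e)
      up-y : Up e y → 4 ≤ toll x e + toll y e
      up-y up = +-mono-≤ (1≤toll x e) (≤-reflexive (≡-sym (toll-up (core-step core l) (link-sym l) up)))

    -- Lying on a core link is symmetric in the two ends, so outside the core both pay 2; inside,
    -- the upward end pays 3 and the other at least 1.
    toll-ends : ∀ {x e y} → x ~ e → y ~ e → x ≢ y → 4 ≤ toll x e + toll y e
    toll-ends {x} {e} {y} xe ye x≢y = split (core? x ×-dec linked? x e)
      where
      reattach : ∀ {p q} → q ~ e → p ≢ q → ∃[ z ] Link p e z → Link p e q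
      reattach qe p≢q (z , l) = subst (Link _ e) (≡-sym (other-end l qe (≢-sym p≢q))) l
      split : Dec (Core x × ∃[ z ] Link x e z) → 4 ≤ toll x e + toll y e
      split (yes (core , l)) = link-tolls core (reattach ye x≢y l)
      split (no out)         = ≤-reflexive (≡-sym (cong₂ _+_ (toll-outside out) (toll-outside out′)))
        where
        out′ : ¬ (Core y × ∃[ z ] Link y e z)
        out′ (core , l) =
          let l′ = reattach xe (≢-sym x≢y) l
          in out (core-step core l′ , y , link-sym l′)

    given got : V → ℕ
    given v = sum (map (pay v) (N v))
    got v = sum (map (λ x → pay x v) (N v))

    -- The final charge is nonnegative, written without subtraction. The factor `positive` leaves
    -- isolated vertices out of the count.
    Balanced : V → Set
    Balanced v = 14 * positive (deg v) + given v ≤ 5 * deg v + got v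

    balance : ∀ {v d g r} → deg v ≡ suc d → given v ≤ g → r ≤ got v → 14 + g ≤ 5 * suc d + r → Balanced v
    balance {v} {d} d≡ given≤ ≤got g≤r = subst (λ k → 14 * positive k + given v ≤ 5 * k + got v) (≡-sym d≡)
      (≤-trans (+-monoʳ-≤ 14 given≤) (≤-trans g≤r (+-monoʳ-≤ (5 * suc d) ≤got)))

    balanced-2 : ∀ v → deg v ≡ 2 → Balanced v
    balanced-2 v d with two-elements d
    ... | x , y , eq = balance d (≤-reflexive given≡0) (≤-trans (toll-ends vx vy distinct) (≤-reflexive (≡-sym got≡))) ≤-refl
      where
      vx : x ~ v
      vx = ~-sym (∈N⁻ (subst (x ∈_) (≡-sym eq) (here refl)))
      vy : y ~ v
      vy = ~-sym (∈N⁻ (subst (y ∈_) (≡-sym eq) (there (here refl))))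
      distinct : x ≢ y
      distinct with subst Unique eq (N! v)
      ... | (p ∷ []) ∷ _ = p
      given≡0 : given v ≡ 0
      given≡0 = trans (cong (λ l → sum (map (pay v) l)) eq)
        (cong₂ (λ p q → p + (q + 0)) (pays-none (~-sym vx)) (pays-none (~-sym vy)))
        where
        pays-none : ∀ {u} → v ~ u → pay v u ≡ 0
        pays-none {u} vu = trans (cong (λ k → amount (deg u) k (toll v u)) d) (amount-2-2 (¬2-2-edge vu d))
      got≡ : got v ≡ toll x v + toll y v
      got≡ = trans (cong (λ l → sum (map (λ x → pay x v) l)) eq)
        (trans (cong (λ k → amount k (deg x) (toll x v) + (amount k (deg y) (toll y v) + 0)) d)
          (cong (toll x v +_) (+-identityʳ _)))

    -- A 3-vertex adjacent to a 2-vertex is not easy: it has no other neighbour of degree 2, and one of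
    -- degree at least 4.
    repaid : ∀ {a b c t u v} → DegreeView a → DegreeView b → DegreeView c →
      a ≤ D → b ≤ D → c ≤ D →
      (a ≡ 2 ⊎ b ≡ 2 ⊎ c ≡ 2 → ¬ (a ∸ 1) + ((b ∸ 1) + ((c ∸ 1) + 0)) ≤ D + 1) →
      amount a 3 2 + (amount b 3 2 + (amount c 3 2 + 0)) ≤
      1 + (amount 3 a t + (amount 3 b u + (amount 3 c v + 0)))
    repaid {a} {b} {c} = λ where
        two two _ _ _ c≤ h → ⊥-elim (h (inj₁ refl) (subst (_≤ D + 1) (cong (2 +_) (≡-sym (+-identityʳ _))) (two-two c≤)))
        two _ two _ b≤ _ h → ⊥-elim (h (inj₁ refl) (subst (_≤ D + 1) (cong suc (+-comm 1 (b ∸ 1))) (two-two b≤)))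
        _ two two a≤ _ _ h → ⊥-elim (h (inj₂ (inj₁ refl)) (subst (_≤ D + 1) (+-comm 2 (a ∸ 1)) (two-two a≤)))
        two three three _ _ _ h → ⊥-elim (h (inj₁ refl) 5≤)
        three two three _ _ _ h → ⊥-elim (h (inj₂ (inj₁ refl)) 5≤)
        three three two _ _ _ h → ⊥-elim (h (inj₂ (inj₂ refl)) 5≤)
        two (large _) (large _) _ _ _ _ → s≤s (s≤s z≤n)
        two (large _) three     _ _ _ _ → ≤-refl
        two three     (large _) _ _ _ _ → ≤-refl
        (large _) two (large _) _ _ _ _ → s≤s (s≤s z≤n)
        (large _) two three     _ _ _ _ → ≤-refl
        three     two (large _) _ _ _ _ → ≤-refl
        (large _) (large _) two _ _ _ _ → s≤s (s≤s z≤n)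
        (large _) three     two _ _ _ _ → ≤-refl
        three     (large _) two _ _ _ _ → ≤-refl
        three     three     three     _ _ _ _ → z≤n
        three     three     (large _) _ _ _ _ → z≤n
        three     (large _) three     _ _ _ _ → z≤n
        three     (large _) (large _) _ _ _ _ → z≤n
        (large _) three     three     _ _ _ _ → z≤n
        (large _) three     (large _) _ _ _ _ → z≤n
        (large _) (large _) three     _ _ _ _ → z≤n
        (large _) (large _) (large _) _ _ _ _ → z≤n
      where
      5≤ : 5 ≤ D + 1
      5≤ = +-monoˡ-≤ 1 4≤D
      two-two : ∀ {d} → d ≤ D → 2 + (d ∸ 1) ≤ D + 1
      two-two {d} d≤D = begin
        1 + (1 + (d ∸ 1)) ≤⟨ +-monoʳ-≤ 2 (∸-monoˡ-≤ 1 d≤D) ⟩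
        1 + (1 + (D ∸ 1)) ≡⟨ cong (1 +_) (m+[n∸m]≡n (≤-trans (s≤s z≤n) 4≤D)) ⟩
        1 + D             ≡⟨ +-comm 1 D ⟩
        D + 1             ∎
        where open ≤-Reasoning

    balanced-3 : ∀ v → deg v ≡ 3 → Balanced v
    balanced-3 v d with three-elements d
    ... | a , b , c , eq = balance d (≤-reflexive given≡) (≤-reflexive got≡) (+-monoʳ-≤ 14
        (repaid (degreeView (~-sym va)) (degreeView (~-sym vb)) (degreeView (~-sym vc))
          (deg≤D a) (deg≤D b) (deg≤D c) ¬easy))
      where
      va : v ~ a
      va = ∈N⁻ (subst (a ∈_) (≡-sym eq) (here refl))
      vb : v ~ b
      vb = ∈N⁻ (subst (b ∈_) (≡-sym eq) (there (here refl)))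
      vc : v ~ c
      vc = ∈N⁻ (subst (c ∈_) (≡-sym eq) (there (there (here refl))))
      easy : ∀ {e} → v ~ e → deg e ≡ 2 → Easy e
      easy ve de = easy-2-vertex de ve (≤-reflexive d)
      pay≡ : ∀ {e} → v ~ e → pay v e ≡ amount (deg e) 3 2
      -- A 2-neighbour of a 3-vertex is easy, so it is not a core link and its toll is the ordinary
      -- 2.
      pay≡ {e} ve = trans (cong (λ k → amount (deg e) k (toll v e)) d) (amount-3-3 (deg e) λ de → toll-outside λ (core , _ , l) →
        core-link-¬easy core l (easy ve de))
      ¬easy : deg a ≡ 2 ⊎ deg b ≡ 2 ⊎ deg c ≡ 2 →
        ¬ (deg a ∸ 1) + ((deg b ∸ 1) + ((deg c ∸ 1) + 0)) ≤ D + 1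
      ¬easy a2 S≤ = [ none va , [ none vb , none vc ]′ ]′ a2
        where
        none : ∀ {e} → v ~ e → ¬ deg e ≡ 2
        none ve de = ¬easy-edge ve (≤-trans (length-conf v)
          (subst (λ l → sum (map (λ w → deg w ∸ 1) l) ≤ D + 1) (≡-sym eq) S≤)) (easy ve de)
      given≡ : given v ≡ amount (deg a) 3 2 + (amount (deg b) 3 2 + (amount (deg c) 3 2 + 0))
      given≡ = trans (cong (λ l → sum (map (pay v) l)) eq)
        (cong₂ _+_ (pay≡ va) (cong₂ _+_ (pay≡ vb) (cong (_+ 0) (pay≡ vc))))
      got≡ : amount 3 (deg a) (toll a v) + (amount 3 (deg b) (toll b v) + (amount 3 (deg c) (toll c v) + 0)) ≡ got v
      got≡ = ≡-sym (trans (cong (λ l → sum (map (λ x → pay x v) l)) eq)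
        (cong (λ k → amount k (deg a) (toll a v) + (amount k (deg b) (toll b v) + (amount k (deg c) (toll c v) + 0))) d))

    balanced-4 : ∀ v → deg v ≡ 4 → Balanced v
    balanced-4 v d = split (core? v)
      where
      -- At most one upward link, costing 3, and at most 1 for each other neighbour: within the
      -- surplus of 6.
      inside : Core v → given v ≤ 4 * 1 + 2
      inside core = subst (λ k → given v ≤ k * 1 + 2) d
        (sum-one-exception (λ u → Up u v) (λ u → up? u v) (pay v) 1 2 (N! v)
          (λ _ _ → up-unique)
          (λ {u} u∈ ¬up → amount-≤ (deg u) (deg v) ≤-refl λ du →
            ≤-reflexive (toll-down core (proj₂ (link-from d (∈N⁻ u∈) du)) ¬up))
          (λ {u} _ → amount-≤ (deg u) (deg v) (s≤s z≤n) λ _ → toll≤3 v u))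
      outside : ¬ Core v → given v ≤ 6
      outside ¬core = begin
        given v                        ≡⟨ sum-cong (N v) (λ u → trans
                                            (cong₂ (amount (deg u)) d (toll-outside (¬core ∘ proj₁)))
                                            (amount-weight (deg u) 0)) ⟩
        -- Paying more than 6 would make `v` heavy, contradicting `¬core`.
        sum (map (weight ∘ deg) (N v)) ≤⟨ ≮⇒≥ (λ 7≤ → heavy-core (d , ≤⇒≤ᵇ 7≤) ¬core) ⟩
        6                              ∎
        where open ≤-Reasoning
      split : Dec (Core v) → Balanced v
      split (yes core) = balance d (inside core) z≤n ≤-refl
      split (no ¬core) = balance d (outside ¬core) z≤n ≤-refl

    -- At most 2 per neighbour and 1 extra for the upward link; 5d - 14 covers 2d + 1 exactly when d
    -- is at least 5.
    balanced-5⁺ : ∀ v {k} → deg v ≡ 5 + k → Balanced v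
    balanced-5⁺ v {k} d = balance {r = 0} d bound z≤n slack
      where
      open ≤-Reasoning
      bound : given v ≤ (5 + k) * 2 + 1
      bound = subst (λ k → given v ≤ k * 2 + 1) d
        (sum-one-exception (λ u → Up u v) (λ u → up? u v) (pay v) 2 1 (N! v)
          (λ _ _ → up-unique)
          (λ {u} _ ¬up → amount-≤ (deg u) (deg v) (s≤s z≤n) λ _ → toll-¬up ¬up)
          (λ {u} _ → amount-≤ (deg u) (deg v) (s≤s z≤n) λ _ → toll≤3 v u))
      slack : 14 + ((5 + k) * 2 + 1) ≤ 5 * (5 + k) + 0
      slack = begin
        14 + ((5 + k) * 2 + 1) ≡⟨ cong (14 +_) (+-comm ((5 + k) * 2) 1) ⟩
        25 + k * 2             ≤⟨ +-monoʳ-≤ 25 (*-monoʳ-≤ k (m≤m+n 2 3)) ⟩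
        25 + k * 5             ≡⟨ *-comm (5 + k) 5 ⟩
        5 * (5 + k)            ≡⟨ +-identityʳ _ ⟨
        5 * (5 + k) + 0        ∎

    balanced : ∀ v → Balanced v
    balanced v = by-degree (N v) refl
      where
      by-degree : ∀ l → N v ≡ l → Balanced v
      by-degree []                      eq =
        subst (λ l → 14 * positive (length l) + sum (map (pay v) l) ≤ 5 * deg v + got v) (≡-sym eq) z≤n
      by-degree (_ ∷ [])                eq = ⊥-elim (deg≢1 v (cong length eq))
      by-degree (_ ∷ _ ∷ [])            eq = balanced-2 v (cong length eq)
      by-degree (_ ∷ _ ∷ _ ∷ [])        eq = balanced-3 v (cong length eq)
      by-degree (_ ∷ _ ∷ _ ∷ _ ∷ [])    eq = balanced-4 v (cong length eq)
      by-degree (_ ∷ _ ∷ _ ∷ _ ∷ _ ∷ l) eq = balanced-5⁺ v (cong length eq)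

    vertices : List V
    vertices = allFin (n G)

    given-over-all : ∀ v → given v ≡ sum (map (λ u → if adj G v u then pay v u else 0) vertices)
    given-over-all v = sum-filter (adj G v) (pay v) vertices

    got-over-all : ∀ v → got v ≡ sum (map (λ x → if adj G x v then pay x v else 0) vertices)
    got-over-all v = trans (sum-filter (adj G v) (λ x → pay x v) vertices)
      (sum-cong vertices λ x → cong (λ b → if b then pay x v else 0) (sym G v x))

    -- Double counting of payments over ordered adjacent pairs.
    given≡got : sum (map given vertices) ≡ sum (map got vertices)
    given≡got = trans (sum-cong vertices given-over-all)
      (trans (sum-swap (λ v u → if adj G v u then pay v u else 0) vertices vertices)
        (≡-sym (sum-cong vertices got-over-all)))

    dense : 14 * sum (map (positive ∘ deg) vertices) ≤ 5 * sum (map deg vertices)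
    dense = +-cancelʳ-≤ (sum (map given vertices)) _ _ (begin
      14 * sum (map (positive ∘ deg) vertices) + sum (map given vertices)
        ≡⟨ cong (_+ sum (map given vertices)) (sum-* 14 (positive ∘ deg) vertices) ⟨
      sum (map (λ v → 14 * positive (deg v)) vertices) + sum (map given vertices)
        ≡⟨ sum-+ (λ v → 14 * positive (deg v)) given vertices ⟨
      sum (map (λ v → 14 * positive (deg v) + given v) vertices)
        ≤⟨ sum-mono-≤ vertices (λ {v} _ → balanced v) ⟩
      sum (map (λ v → 5 * deg v + got v) vertices)
        ≡⟨ sum-+ (λ v → 5 * deg v) got vertices ⟩
      sum (map (λ v → 5 * deg v) vertices) + sum (map got vertices)
        ≡⟨ cong₂ _+_ (sum-* 5 deg vertices) (≡-sym given≡got) ⟩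
      5 * sum (map deg vertices) + sum (map given vertices) ∎)
      where open ≤-Reasoning

  -- The subgraph that violates the density bound; isolated vertices would only lower its average
  -- degree.
  nonIsolated : Subgraph G
  nonIsolated = record
    { S = λ v → 0 <ᵇ deg v ; F = adj G ; Fsym = sym G
    ; Fsub = λ u v uv → T-∧⁺ uv (T-∧⁺ (inhabited (∈N⁺ uv)) (inhabited (∈N⁺ (~-sym uv)))) }
    where
    T-∧⁺ : ∀ {x y} → T x → T y → T (x ∧ y)
    T-∧⁺ {true} _ y = y
    inhabited : ∀ {v} {l : List V} → v ∈ l → T (0 <ᵇ length l)
    inhabited (here _)  = tt
    inhabited (there _) = tt

  -- Without edges a constant colouring is injective. An edge makes `nonIsolated` nonempty.
  some-edge : ∃[ u ] ∃[ v ] u ~ v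
  some-edge with any? (λ u → any? (λ v → T? (adj G u v)))
  ... | yes e = e
  ... | no ¬e = ⊥-elim (¬colourable
    ((λ _ → fromℕ< {0} (≤-trans (s≤s z≤n) (m≤n+m 2 D))) , λ u _ w _ uw _ → ⊥-elim (¬e (u , w , uw))))

  ¬sparse : ¬ madLt14/5 G
  ¬sparse mad =
    ¬¬-decide Core λ core? → ¬¬-decide₂ (λ x e → ∃[ y ] Link x e y) λ linked? → ¬¬-decide₂ Up λ up? →
    <⇒≱ (mad nonIsolated nonempty) (subst₂ _≤_
      (cong (14 *_) (sum-cong vertices (λ v → indicator (deg v))))
      (cong (5 *_) (sum-cong vertices deg≡degree))
      (Discharge.dense core? linked? up?))
    where
    vertices : List V
    vertices = allFin (n G)
    indicator : ∀ d → positive d ≡ (if 0 <ᵇ d then 1 else 0)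
    indicator 0       = refl
    indicator (suc _) = refl
    nonempty : 0 < vcount G nonIsolated
    nonempty =
      let (u , v , uv) = some-edge
      in subst (_< vcount G nonIsolated) (sum-0 vertices)
           (sum-mono-< (λ _ → z≤n) (∈-allFin u) (counted (∈N⁺ uv)))
      where
      counted : ∀ {v} {l : List V} → v ∈ l → 0 < (if 0 <ᵇ length l then 1 else 0)
      counted (here _)  = s≤s z≤n
      counted (there _) = s≤s z≤n

-- Induction on the number of edges

size : Graph → ℕ
size G = sum (map (degree G) (allFin (n G)))

-- The bound `D` is kept fixed instead of the maximum degree, which may drop when an edge is
-- deleted. Decidability of colourability permits the argument by contradiction.
colourable : ∀ {D} → 4 ≤ D → (G : Graph) → Acc _<_ (size G) → (∀ v → degree G v ≤ D) →
  madLt14/5 G → χi≤ G (D + 2)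
colourable {D} 4≤D G (acc smaller) degree≤D mad =
  decidable-stable (χi≤? G (D + 2)) λ ¬colourable →
    Critical.¬sparse G D 4≤D degree≤D ¬colourable
      (λ {u} {v} uv → colourable 4≤D (deleteEdge G u v) (smaller (size-deleteEdge G uv))
        (λ a → ≤-trans (degree-deleteEdge G a) (degree≤D a)) (mad-deleteEdge G mad))
      mad

degree≤maxDegree : (G : Graph) → ∀ v → degree G v ≤ maxDegree G
degree≤maxDegree G v = go (∈-allFin v)
  where
  go : ∀ {l} → v ∈ l → degree G v ≤ foldr _⊔_ 0 (map (degree G) l)
  go (here refl)         = m≤m⊔n (degree G v) _
  go {u ∷ _} (there v∈l) = ≤-trans (go v∈l) (m≤n⊔m (degree G u) _)

theorem1 : (G : Graph) → 4 ≤ maxDegree G → madLt14/5 G → χi≤ G (maxDegree G + 2)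
theorem1 G 4≤Δ = colourable 4≤Δ G (<-wellFounded (size G)) (degree≤maxDegree G)
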